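{- Let $k\ge 3$ be an integer and let $E: a_1x_1+\dots+a_kx_k=0$ be a linear equation with coefficients $a_i\in\mathbb{Z}\setminus\{0\}$ for each $i=1,\dots,k$. If $E$ is $2$-uncommon over the integers, then $E$ is also $r$-uncommon over the integers for every integer $r\ge 3$.
   Context: Write $[n]=\{1,\dots,n\}$. Let $E: a_1x_1+\dots+a_kx_k=0$ be a linear equation with nonzero integer coefficients, and let $r\ge 2$ be an integer. An $r$-coloring of $[n]$ is a map $c:[n]\to\{1,\dots,r\}$; a solution $(x_1,\dots,x_k)\in[n]^k$ of $E$ is monochromatic if $c(x_1)=\dots=c(x_k)$. The equation $E$ is $r$-common over the integers if any $r$-coloring of $[n]$ has at least as many monochromatic solutions asymptotically (as $n\to\infty$) as a uniformly random $r$-coloring; that is, the minimum over all $r$-colorings of $[n]$ of the proportion of solutions of $E$ in $[n]^k$ that are monochromatic is at least $r^{1-k}-o(1)$ as $n\to\infty$. Otherwise $E$ is $r$-uncommon over the integers. -}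

module Defs where

import Algebra.Properties.Semiring.Sum
open import Data.Fin.Base using (Fin; toℕ)
open import Data.Fin.Properties using (all?) renaming (_≟_ to _≟ᶠ_)
open import Data.Integer.Base using (ℤ; +_; 0ℤ; _*_)
open import Data.Integer.Properties using (+-*-semiring) renaming (_≟_ to _≟ᶻ_)
open import Data.List.Base using (List; []; _∷_; length; filter; cartesianProductWith; allFin)
open import Data.Nat.Base as ℕ using (ℕ; zero; suc; _^_; _∸_; NonZero; NonTrivial; nonTrivial⇒nonZero)
open import Data.Nat.Properties using (m^n≢0)
open import Data.Product.Base using (∃)
open import Data.Rational.Unnormalised.Base as ℚ using (ℚᵘ; 0ℚᵘ; _/_)
open import Data.Vec.Functional as Vector using (Vector)
open import Relation.Binary.PropositionalEquality using (_≡_)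
open import Relation.Nullary using (¬_; Dec)

open Algebra.Properties.Semiring.Sum +-*-semiring using (sum)

-- Fin n plays the role of [n] = {1,…,n}: the index i stands for the integer i + 1.
value : ∀ {n} → Fin n → ℤ
value i = + suc (toℕ i)

-- Every element of [n]^k, each listed exactly once.
tuples : ∀ k n → List (Vector (Fin n) k)
tuples zero    n = Vector.[] ∷ []
tuples (suc k) n = cartesianProductWith Vector._∷_ (allFin n) (tuples k n)

Colouring : ℕ → ℕ → Set
Colouring r n = Fin n → Fin r

IsSolution : ∀ {k n} → Vector ℤ k → Vector (Fin n) k → Set
IsSolution a x = sum (λ i → a i * value (x i)) ≡ 0ℤ

isSolution? : ∀ {k n} (a : Vector ℤ k) (x : Vector (Fin n) k) → Dec (IsSolution a x)
isSolution? a x = sum (λ i → a i * value (x i)) ≟ᶻ 0ℤ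

Monochromatic : ∀ {k n r} → Colouring r n → Vector (Fin n) k → Set
Monochromatic c x = ∀ i j → c (x i) ≡ c (x j)

monochromatic? : ∀ {k n r} (c : Colouring r n) (x : Vector (Fin n) k) →
                 Dec (Monochromatic c x)
monochromatic? c x = all? λ i → all? λ j → c (x i) ≟ᶠ c (x j)

solutions : ∀ {k} → Vector ℤ k → (n : ℕ) → List (Vector (Fin n) k)
solutions {k} a n = filter (isSolution? a) (tuples k n)

#solutions : ∀ {k} → Vector ℤ k → ℕ → ℕ
#solutions a n = length (solutions a n)

#monochromatic : ∀ {k n r} → Vector ℤ k → Colouring r n → ℕ
#monochromatic {n = n} a c = length (filter (monochromatic? c) (solutions a n))

-- The proportion is only defined when there is at least one solution in [n]^k.
proportion : ∀ {k n r} (a : Vector ℤ k) → .{{NonZero (#solutions a n)}} →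
             Colouring r n → ℚᵘ
proportion {n = n} a c = + #monochromatic a c / #solutions a n

-- r^(1-k), for k ≥ 1.
randomProportion : (r k : ℕ) .{{_ : NonTrivial r}} → ℚᵘ
randomProportion r k = (+ 1 / (r ^ (k ∸ 1))) {{m^n≢0 r (k ∸ 1) {{nonTrivial⇒nonZero r}}}}

-- The minimum over colourings is at least r^(1-k) - o(1): a lower bound on the
-- minimum is a lower bound for each colouring, uniformly in the colouring.
-- Those n for which [n]^k contains no solution impose no condition.
Common : ∀ {k} (r : ℕ) .{{_ : NonTrivial r}} → Vector ℤ k → Set
Common {k} r a =
  ∀ (ε : ℚᵘ) → 0ℚᵘ ℚ.< ε →
  ∃ λ N → ∀ n → N ℕ.≤ n → .{{_ : NonZero (#solutions a n)}} →
  (c : Colouring r n) → randomProportion r k ℚ.- ε ℚ.≤ proportion a c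

Uncommon : ∀ {k} (r : ℕ) .{{_ : NonTrivial r}} → Vector ℤ k → Set
Uncommon r a = ¬ Common r a

{-# OPTIONS --safe #-}

-- A red/blue colouring c of [n] with too few monochromatic solutions is turned into an
-- r-colouring: independently at each point, draw one of the r colours uniformly and replace it
-- by the red/blue colour of c if it is one of the first two. At a solution with distinct
-- coordinates the number of monochromatic outcomes, out of r^k equally likely ones, is
-- 2^k [x monochromatic for c] + (r - 2), so if c beats the random 2-colouring then on average
-- the new colourings beat the random r-colouring. Solutions with a repeated coordinate are
-- negligible: there are O(n^(k-2)) of them, while a single solution, dilated and perturbed
-- along the solution lattice, already yields a positive proportion of n^(k-1) solutions.
-- Contrapositively, summing the r-common bound over all draws gives the 2-common bound.

module Submission where

open import Defs
open import Data.Bool.Base using (if_then_else_)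
open import Data.Empty using (⊥-elim)
open import Data.Fin.Base using (Fin; zero; suc; toℕ; fromℕ<; _↑ˡ_; punchIn; combine; remQuot;
    finToFun; funToFin)
open import Data.Fin.Properties using (all?; any?; suc-injective; toℕ<n; toℕ-fromℕ<;
    toℕ-injective; punchInᵢ≢i; combine-injective; combine-remQuot; funToFin-finToFin;
    finToFun-funToFin; injective⇒≤) renaming (_≟_ to _≟ᶠ_)
open import Data.Integer.Base as ℤ using (ℤ; +_; -[1+_]; 0ℤ; ∣_∣; +≤+)
import Data.Integer.Properties as ℤ
open import Data.Integer.Tactic.RingSolver using () renaming (solve-∀ to ℤ-solve-∀)
open import Data.List.Base using (List; []; _∷_; _++_; map; length; lookup; filter; allFin;
    cartesianProductWith)
open import Data.List.Properties using (map-cong; map-tabulate; map-++; map-∘; length-tabulate)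
open import Data.List.Membership.Propositional using (_∈_)
import Data.List.Membership.Propositional.Properties as ∈
import Data.List.Membership.Setoid.Properties as Membership
open import Data.List.Relation.Unary.All as All using (All; []; _∷_)
open import Data.List.Relation.Unary.All.Properties using (all-filter)
open import Data.List.Relation.Unary.AllPairs using ([]; _∷_)
open import Data.List.Relation.Unary.Any as Any using (Any; here)
import Data.List.Relation.Unary.Unique.Propositional.Properties as ≡Unique
import Data.List.Relation.Unary.Unique.Setoid as Unique
import Data.List.Relation.Unary.Unique.Setoid.Properties as Unique
open import Data.Nat.Base as ℕ using (ℕ; zero; suc; _+_; _*_; _∸_; _^_; _≤_; _<_; z≤n; s≤s; s≤s⁻¹;
    NonZero; NonTrivial; >-nonZero; >-nonZero⁻¹; ≢-nonZero⁻¹)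
open import Data.Nat.DivMod using (m≡m%n+[m/n]*n; m%n<n; m/n*n≤m; m≥n⇒m/n>0)
open import Data.Nat.ListAction using () renaming (sum to sumᴸ)
open import Data.Nat.ListAction.Properties using (sum-++)
open import Data.Nat.Properties as ℕ hiding (suc-injective)
open import Data.Nat.Tactic.RingSolver using (solve-∀)
open import Data.Product.Base using (_,_; _×_; proj₁; proj₂; ∃; ∃₂)
open import Data.Rational.Unnormalised.Base as ℚ using (0ℚᵘ; mkℚᵘ; _/_; ↧ₙ_; *≤*; *<*)
import Data.Rational.Unnormalised.Properties as ℚ
open import Data.Vec.Functional as Vector using (Vector)
open import Data.Vec.Functional.Properties using (updateAt-updates; updateAt-minimal)
open import Function.Base using (_∘_; id; case_of_)
open import Function.Definitions using (Injective)
open import Relation.Binary.Bundles using (Setoid)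
open import Relation.Binary.PropositionalEquality
open import Relation.Nullary
open import Relation.Nullary.Decidable using (decidable-stable)
open import Algebra.Properties.AbelianGroup ℤ.+-0-abelianGroup using (∙-cancelˡ; ∙-cancelʳ)
open import Algebra.Properties.CommutativeSemigroup ℕ.*-commutativeSemigroup using ()
    renaming (x∙yz≈y∙xz to *-left-comm; interchange to *-interchange)
open import Algebra.Properties.CommutativeSemigroup ℕ.+-commutativeSemigroup using ()
    renaming (interchange to +-interchange)
open import Algebra.Properties.Semiring.Sum ℤ.+-*-semiring using (sum; sum-cong-≗; sum-remove;
    *-distribˡ-sum; ∑-distrib-+)
open import Algebra.Properties.Semiring.Sum ℕ.+-*-semiring using () renaming (sum to sumℕ)

private variable
  A B : Set
  k n r : ℕ

-- Sums and products

𝟙 : Dec A → ℕ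
𝟙 P? = if does P? then 1 else 0

𝟙-true : (P? : Dec A) → A → 𝟙 P? ≡ 1
𝟙-true (yes _) p = refl
𝟙-true (no ¬p) p = contradiction p ¬p

𝟙-false : (P? : Dec A) → ¬ A → 𝟙 P? ≡ 0
𝟙-false (yes p) ¬p = contradiction p ¬p
𝟙-false (no _)  ¬p = refl

𝟙≤1 : (P? : Dec A) → 𝟙 P? ≤ 1
𝟙≤1 (yes _) = ≤-refl
𝟙≤1 (no _)  = z≤n

𝟙-⇔ : (A → B) → (B → A) → (P? : Dec A) (Q? : Dec B) → 𝟙 P? ≡ 𝟙 Q?
𝟙-⇔ to from (yes p) Q? = sym (𝟙-true Q? (to p))
𝟙-⇔ to from (no ¬p) Q? = sym (𝟙-false Q? (¬p ∘ from))

𝟙-× : (P? : Dec A) (Q? : Dec B) → 𝟙 (P? ×-dec Q?) ≡ 𝟙 P? * 𝟙 Q?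
𝟙-× (yes _) Q? = sym (+-identityʳ _)
𝟙-× (no _)  Q? = refl

∑ : List A → (A → ℕ) → ℕ
∑ xs f = sumᴸ (map f xs)

∑-cong : ∀ (xs : List A) {f g : A → ℕ} → (∀ x → f x ≡ g x) → ∑ xs f ≡ ∑ xs g
∑-cong xs f≗g = cong sumᴸ (map-cong f≗g xs)

∑-mono : ∀ (xs : List A) {f g : A → ℕ} → (∀ x → f x ≤ g x) → ∑ xs f ≤ ∑ xs g
∑-mono []       f≤g = z≤n
∑-mono (x ∷ xs) f≤g = +-mono-≤ (f≤g x) (∑-mono xs f≤g)

∑-+ : ∀ (xs : List A) (f g : A → ℕ) → ∑ xs (λ x → f x + g x) ≡ ∑ xs f + ∑ xs g
∑-+ []       f g = refl
∑-+ (x ∷ xs) f g = trans (cong (λ z → f x + g x + z) (∑-+ xs f g)) (+-interchange (f x) (g x) _ _)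

∑-*ˡ : ∀ (xs : List A) c (f : A → ℕ) → ∑ xs (λ x → c * f x) ≡ c * ∑ xs f
∑-*ˡ []       c f = sym (*-zeroʳ c)
∑-*ˡ (x ∷ xs) c f = trans (cong (λ z → c * f x + z) (∑-*ˡ xs c f)) (sym (*-distribˡ-+ c (f x) _))

∑-const : ∀ (xs : List A) c → ∑ xs (λ _ → c) ≡ length xs * c
∑-const []       c = refl
∑-const (x ∷ xs) c = cong (λ z → c + z) (∑-const xs c)

∑-swap : ∀ (xs : List A) (ys : List B) (f : A → B → ℕ) →
         ∑ xs (λ x → ∑ ys (f x)) ≡ ∑ ys (λ y → ∑ xs (λ x → f x y))
∑-swap []       ys f = sym (trans (∑-const ys 0) (*-zeroʳ (length ys)))
∑-swap (x ∷ xs) ys f = trans (cong (λ z → ∑ ys (f x) + z) (∑-swap xs ys f)) (sym (∑-+ ys (f x) _))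

∑-++ : ∀ (xs ys : List A) (f : A → ℕ) → ∑ (xs ++ ys) f ≡ ∑ xs f + ∑ ys f
∑-++ xs ys f = trans (cong sumᴸ (map-++ f xs ys)) (sum-++ (map f xs) (map f ys))

∑-cartesianProductWith : ∀ {C : Set} (g : A → B → C) xs ys (f : C → ℕ) →
  ∑ (cartesianProductWith g xs ys) f ≡ ∑ xs (λ x → ∑ ys (λ y → f (g x y)))
∑-cartesianProductWith g []       ys f = refl
∑-cartesianProductWith g (x ∷ xs) ys f =
  trans (∑-++ (map (g x) ys) _ f)
        (cong₂ _+_ (cong sumᴸ (sym (map-∘ ys))) (∑-cartesianProductWith g xs ys f))

∑-tuples : ∀ k n (f : Vector (Fin n) (suc k) → ℕ) →
  ∑ (tuples (suc k) n) f ≡ ∑ (allFin n) (λ s → ∑ (tuples k n) (λ t → f (s Vector.∷ t)))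
∑-tuples k n = ∑-cartesianProductWith Vector._∷_ (allFin n) (tuples k n)

∑-allFin-suc : ∀ n (f : Fin (suc n) → ℕ) → ∑ (allFin (suc n)) f ≡ f zero + ∑ (allFin n) (f ∘ suc)
∑-allFin-suc n f = cong (λ xs → f zero + sumᴸ xs)
  (trans (map-tabulate suc f) (sym (map-tabulate id (f ∘ suc))))

length-allFin : ∀ n → length (allFin n) ≡ n
length-allFin n = length-tabulate id

length-filter : {P : A → Set} (P? : ∀ x → Dec (P x)) (xs : List A) →
                length (filter P? xs) ≡ ∑ xs (λ x → 𝟙 (P? x))
length-filter P? []       = refl
length-filter P? (x ∷ xs) with P? x
... | yes _ = cong suc (length-filter P? xs)
... | no _  = length-filter P? xs

∑-allFin-δ : ∀ (d : Fin n) → ∑ (allFin n) (λ j → 𝟙 (d ≟ᶠ j)) ≡ 1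
∑-allFin-δ {suc n} zero = trans (∑-allFin-suc n (λ j → 𝟙 (zero ≟ᶠ j))) (cong suc
  (trans (∑-const (allFin n) 0) (*-zeroʳ (length (allFin n)))))
∑-allFin-δ {suc n} (suc d) = trans (∑-allFin-suc n (λ j → 𝟙 (suc d ≟ᶠ j)))
  (trans (∑-cong (allFin n) (λ j → 𝟙-⇔ suc-injective (cong suc) (suc d ≟ᶠ suc j) (d ≟ᶠ j)))
         (∑-allFin-δ d))

∏ : Vector ℕ k → ℕ
∏ = Vector.foldr _*_ 1

∏-cong : {f g : Vector ℕ k} → f ≗ g → ∏ f ≡ ∏ g
∏-cong {zero}  f≗g = refl
∏-cong {suc k} f≗g = cong₂ _*_ (f≗g zero) (∏-cong (f≗g ∘ suc))

∏-*ˡ : ∀ c (f : Vector ℕ k) → ∏ (λ i → c * f i) ≡ c ^ k * ∏ f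
∏-*ˡ {zero}  c f = refl
∏-*ˡ {suc k} c f = trans (cong (c * f zero *_) (∏-*ˡ c (f ∘ suc)))
                         (*-interchange c (f zero) (c ^ k) _)

∏-one : ∀ k → ∏ {k} (λ _ → 1) ≡ 1
∏-one zero    = refl
∏-one (suc k) = trans (+-identityʳ _) (∏-one k)

∏-𝟙 : {P : Fin k → Set} (P? : ∀ i → Dec (P i)) → ∏ (λ i → 𝟙 (P? i)) ≡ 𝟙 (all? P?)
∏-𝟙 {zero} P? = sym (𝟙-true (all? P?) λ ())
∏-𝟙 {suc k} P? = trans (cong (𝟙 (P? zero) *_) (∏-𝟙 (P? ∘ suc)))
  (trans (sym (𝟙-× (P? zero) (all? (P? ∘ suc))))
    (𝟙-⇔ (λ { (p , ps) zero → p ; (p , ps) (suc i) → ps i }) (λ ps → ps zero , ps ∘ suc)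
        (P? zero ×-dec all? (P? ∘ suc)) (all? P?)))

-- This brings monochromaticity into the form that independence can handle, a sum over colours of
-- products over coordinates. Only the colour of coordinate `zero` can contribute, so the tuple must
-- be non-empty.
𝟙-monochromatic : (c : Colouring r n) (x : Vector (Fin n) (suc k)) →
  𝟙 (monochromatic? c x) ≡ ∑ (allFin r) (λ j → ∏ (λ i → 𝟙 (c (x i) ≟ᶠ j)))
𝟙-monochromatic {r} {k = k} c x = sym (begin
  ∑ (allFin r) (λ j → ∏ (λ i → 𝟙 (c (x i) ≟ᶠ j)))
    ≡⟨ ∑-cong (allFin r) (λ j → trans (∏-𝟙 (λ i → c (x i) ≟ᶠ j)) (step j)) ⟩
  ∑ (allFin r) (λ j → m * 𝟙 (c (x zero) ≟ᶠ j))
    ≡⟨ ∑-*ˡ (allFin r) m _ ⟩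
  m * ∑ (allFin r) (λ j → 𝟙 (c (x zero) ≟ᶠ j))
    ≡⟨ cong (m *_) (∑-allFin-δ (c (x zero))) ⟩
  m * 1
    ≡⟨ *-identityʳ m ⟩
  m ∎)
  where
  open ≡-Reasoning
  m = 𝟙 (monochromatic? c x)
  step : ∀ j → 𝟙 (all? (λ i → c (x i) ≟ᶠ j)) ≡ m * 𝟙 (c (x zero) ≟ᶠ j)
  step j = trans
    (𝟙-⇔ (λ eq → (λ i i′ → trans (eq i) (sym (eq i′))) , eq zero)
         (λ (mono , eq) i → trans (mono i zero) eq)
         (all? (λ i → c (x i) ≟ᶠ j)) (monochromatic? c x ×-dec (c (x zero) ≟ᶠ j)))
    (𝟙-× (monochromatic? c x) (c (x zero) ≟ᶠ j))

-- Independence of uniform draws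

-- The expectation of a product of independent variables factors: `h` sees only the draw at `p`, and
-- `G` ignores it. The factor `r` on the left clears the denominator of the expectation of `h`.
∑-tuples-independent : ∀ (p : Fin n) (h : Fin r → ℕ) (G : Vector (Fin r) n → ℕ) →
  (∀ ρ ρ′ → (∀ q → q ≢ p → ρ q ≡ ρ′ q) → G ρ ≡ G ρ′) →
  r * ∑ (tuples n r) (λ ρ → h (ρ p) * G ρ) ≡ ∑ (allFin r) h * ∑ (tuples n r) G
∑-tuples-independent {suc n} {r} zero h G indep = begin
  r * ∑ (tuples (suc n) r) (λ ρ → h (ρ zero) * G ρ)
    ≡⟨ cong₂ _*_ (sym (length-allFin r)) (∑-tuples n r _) ⟩
  length R * ∑ R (λ s → ∑ T (λ t → h s * G (s Vector.∷ t)))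
    -- The factor `r` becomes a sum over a fresh draw `s′`. As `G` ignores its first entry, `s′` can
    -- take the place of `s` there, which leaves `s` to `h` alone.
    ≡⟨ sym (∑-const R _) ⟩
  ∑ R (λ s′ → ∑ R (λ s → ∑ T (λ t → h s * G (s Vector.∷ t))))
    ≡⟨ ∑-cong R (λ s′ → ∑-cong R (λ s → trans (∑-cong T (λ t → cong (h s *_) (move s s′ t)))
        (trans (∑-*ˡ T (h s) _) (*-comm (h s) _)))) ⟩
  ∑ R (λ s′ → ∑ R (λ s → ∑ T (λ t → G (s′ Vector.∷ t)) * h s))
    ≡⟨ ∑-cong R (λ s′ → trans (∑-*ˡ R (g s′) h) (*-comm (g s′) (∑ R h))) ⟩
  ∑ R (λ s′ → ∑ R h * ∑ T (λ t → G (s′ Vector.∷ t)))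
    ≡⟨ ∑-*ˡ R (∑ R h) _ ⟩
  ∑ R h * ∑ R (λ s′ → ∑ T (λ t → G (s′ Vector.∷ t)))
    ≡⟨ cong (∑ R h *_) (sym (∑-tuples n r G)) ⟩
  ∑ R h * ∑ (tuples (suc n) r) G ∎
  where
  open ≡-Reasoning
  R = allFin r
  T = tuples n r
  g : Fin r → ℕ
  g s′ = ∑ T (λ t → G (s′ Vector.∷ t))
  move : ∀ s s′ t → G (s Vector.∷ t) ≡ G (s′ Vector.∷ t)
  move s s′ t = indep _ _ λ { zero q≢0 → contradiction refl q≢0 ; (suc q) _ → refl }
∑-tuples-independent {suc n} {r} (suc p) h G indep = begin
  r * ∑ (tuples (suc n) r) (λ ρ → h (ρ (suc p)) * G ρ)
    ≡⟨ cong (r *_) (∑-tuples n r _) ⟩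
  r * ∑ R (λ s → ∑ T (λ t → h (t p) * G (s Vector.∷ t)))
    ≡⟨ sym (∑-*ˡ R r _) ⟩
  ∑ R (λ s → r * ∑ T (λ t → h (t p) * G (s Vector.∷ t)))
    ≡⟨ ∑-cong R (λ s → ∑-tuples-independent p h (λ t → G (s Vector.∷ t))
         (λ t t′ eq → indep _ _ λ { zero _ → refl ; (suc q) q≢p → eq q (q≢p ∘ cong suc) })) ⟩
  ∑ R (λ s → ∑ R h * ∑ T (λ t → G (s Vector.∷ t)))
    ≡⟨ ∑-*ˡ R (∑ R h) _ ⟩
  ∑ R h * ∑ R (λ s → ∑ T (λ t → G (s Vector.∷ t)))
    ≡⟨ cong (∑ R h *_) (sym (∑-tuples n r G)) ⟩
  ∑ R h * ∑ (tuples (suc n) r) G ∎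
  where
  open ≡-Reasoning
  R = allFin r
  T = tuples n r

-- Draws at distinct points are independent, so the factors are split off one at a time, each
-- clearing one denominator `r`.
∑-tuples-∏ : ∀ (x : Vector (Fin n) k) → Injective _≡_ _≡_ x → (h : Fin k → Fin r → ℕ) →
  r ^ k * ∑ (tuples n r) (λ ρ → ∏ (λ i → h i (ρ (x i)))) ≡
  ∏ (λ i → ∑ (allFin r) (h i)) * length (tuples n r)
∑-tuples-∏ {n} {zero} {r} x inj h = cong (_+ 0) (trans (∑-const (tuples n r) 1) (*-identityʳ _))
∑-tuples-∏ {n} {suc k} {r} x inj h = begin
  r * r ^ k * ∑ T (λ ρ → h zero (ρ (x zero)) * G ρ)
    ≡⟨ trans (cong (_* E) (*-comm r (r ^ k))) (*-assoc (r ^ k) r E) ⟩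
  r ^ k * (r * ∑ T (λ ρ → h zero (ρ (x zero)) * G ρ))
    ≡⟨ cong (r ^ k *_) (∑-tuples-independent (x zero) (h zero) G
         -- By injectivity no later coordinate equals `x zero`, so the remaining factors do not see
         -- the draw there.
         (λ ρ ρ′ eq → ∏-cong λ i → cong (h (suc i)) (eq (x (suc i)) (λ e → case inj e of λ ())))) ⟩
  r ^ k * (∑ (allFin r) (h zero) * ∑ T G)
    ≡⟨ *-left-comm (r ^ k) (∑ (allFin r) (h zero)) (∑ T G) ⟩
  ∑ (allFin r) (h zero) * (r ^ k * ∑ T G)
    ≡⟨ cong (∑ (allFin r) (h zero) *_) (∑-tuples-∏ (x ∘ suc) (suc-injective ∘ inj) (h ∘ suc)) ⟩
  ∑ (allFin r) (h zero) * (∏ (λ i → ∑ (allFin r) (h (suc i))) * length T)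
    ≡⟨ sym (*-assoc (∑ (allFin r) (h zero)) _ _) ⟩
  ∏ (λ i → ∑ (allFin r) (h i)) * length T ∎
  where
  open ≡-Reasoning
  T = tuples n r
  G : Vector (Fin r) n → ℕ
  G ρ = ∏ (λ i → h (suc i) (ρ (x (suc i))))
  E = ∑ T (λ ρ → h zero (ρ (x zero)) * G ρ)

-- The random recolouring

-- At these tuples two coordinates share a draw, and the product formula fails.
Degenerate : Vector (Fin n) k → Set
Degenerate x = ∃₂ λ i j → i ≢ j × x i ≡ x j

degenerate? : (x : Vector (Fin n) k) → Dec (Degenerate x)
degenerate? x = any? λ i → any? λ j → ¬? (i ≟ᶠ j) ×-dec (x i ≟ᶠ x j)

¬degenerate⇒injective : (x : Vector (Fin n) k) → ¬ Degenerate x → Injective _≡_ _≡_ x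
¬degenerate⇒injective x ¬deg {i} {j} eq = decidable-stable (i ≟ᶠ j) λ i≢j → ¬deg (i , j , i≢j , eq)

#degenerate : Vector _ k → ℕ → ℕ
#degenerate a n = length (filter degenerate? (solutions a n))

-- The number of colours is written `2 + r`, so `r` now counts only the colours beyond red and blue.
recolour : Fin 2 → Fin (2 + r) → Fin (2 + r)
recolour {r} s zero          = s ↑ˡ r
recolour {r} s (suc zero)    = s ↑ˡ r
recolour     s (suc (suc t)) = suc (suc t)

recolouring : Colouring 2 n → Vector (Fin (2 + r)) n → Colouring (2 + r) n
recolouring c ρ p = recolour (c p) (ρ p)

∑-allFin-2+ : ∀ r (f : Fin (2 + r) → ℕ) →
  ∑ (allFin (2 + r)) f ≡ f zero + (f (suc zero) + ∑ (allFin r) (λ u → f (suc (suc u))))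
∑-allFin-2+ r f = trans (∑-allFin-suc (suc r) f)
  (cong (λ z → f zero + z) (∑-allFin-suc r (f ∘ suc)))

-- This is `2 + r` times the probability that a point of colour `s` ends up with colour `j`.
recolour-weight : Fin 2 → Fin (2 + r) → ℕ
recolour-weight {r} s j = ∑ (allFin (2 + r)) (λ t → 𝟙 (recolour s t ≟ᶠ j))

recolour-weight-old : ∀ (s s′ : Fin 2) → recolour-weight {r} s (s′ ↑ˡ r) ≡ 2 * 𝟙 (s ≟ᶠ s′)
recolour-weight-old {r} s s′ = trans (∑-allFin-2+ r (λ t → 𝟙 (recolour s t ≟ᶠ s′ ↑ˡ r)))
  (cases s s′)
  where
  none : ∑ (allFin r) (λ _ → 0) ≡ 0
  none = trans (∑-const (allFin r) 0) (*-zeroʳ (length (allFin r)))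
  cases : ∀ s s′ → 𝟙 (s ↑ˡ r ≟ᶠ s′ ↑ˡ r) +
      (𝟙 (s ↑ˡ r ≟ᶠ s′ ↑ˡ r) + ∑ (allFin r) (λ u → 𝟙 (suc (suc u) ≟ᶠ s′ ↑ˡ r)))
    ≡ 2 * 𝟙 (s ≟ᶠ s′)
  cases zero       zero       = cong (λ z → 2 + z) none
  cases zero       (suc zero) = none
  cases (suc zero) zero       = none
  cases (suc zero) (suc zero) = cong (λ z → 2 + z) none

recolour-weight-new : ∀ (s : Fin 2) (u : Fin r) → recolour-weight s (suc (suc u)) ≡ 1
recolour-weight-new {r} s u = trans (∑-allFin-2+ r (λ t → 𝟙 (recolour s t ≟ᶠ suc (suc u))))
  (trans (cases s) rest)
  where
  rest : ∑ (allFin r) (λ v → 𝟙 (Fin.suc (suc v) ≟ᶠ suc (suc u))) ≡ 1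
  rest = trans (∑-cong (allFin r) λ v → 𝟙-⇔ (λ { refl → refl }) (λ { refl → refl })
      (suc (suc v) ≟ᶠ suc (suc u)) (u ≟ᶠ v)) (∑-allFin-δ u)
  cases : ∀ s → 𝟙 (s ↑ˡ r ≟ᶠ suc (suc u)) +
      (𝟙 (s ↑ˡ r ≟ᶠ suc (suc u)) + ∑ (allFin r) (λ v → 𝟙 (Fin.suc (suc v) ≟ᶠ suc (suc u))))
    ≡ ∑ (allFin r) (λ v → 𝟙 (Fin.suc (suc v) ≟ᶠ suc (suc u)))
  cases zero       = refl
  cases (suc zero) = refl

-- An old colour contributes `2 ^ suc k` if `c` gives it to every coordinate, and nothing otherwise.
-- Each of the `r` new colours contributes 1, since every coordinate must draw exactly that colour.
∑-∏-recolour-weight : (c : Colouring 2 n) (x : Vector (Fin n) (suc k)) →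
  ∑ (allFin (2 + r)) (λ j → ∏ (λ i → recolour-weight {r} (c (x i)) j)) ≡
  2 ^ suc k * 𝟙 (monochromatic? c x) + r
∑-∏-recolour-weight {k = k} {r} c x = begin
  ∑ (allFin (2 + r)) W
    ≡⟨ ∑-allFin-2+ r W ⟩
  W zero + (W (suc zero) + ∑ (allFin r) (λ u → W (suc (suc u))))
    ≡⟨ cong₂ _+_ (old zero) (cong₂ _+_ (old (suc zero)) (∑-cong (allFin r) new)) ⟩
  2 ^ suc k * V zero + (2 ^ suc k * V (suc zero) + ∑ (allFin r) (λ u → 1))
    ≡⟨ cong (λ z → 2 ^ suc k * V zero + (2 ^ suc k * V (suc zero) + z))
         (trans (∑-const (allFin r) 1) (trans (*-identityʳ _) (length-allFin r))) ⟩
  2 ^ suc k * V zero + (2 ^ suc k * V (suc zero) + r)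
    ≡⟨ regroup (2 ^ suc k) (V zero) (V (suc zero)) r ⟩
  2 ^ suc k * (V zero + (V (suc zero) + 0)) + r
    -- The two products are the expansion of `𝟙-monochromatic` for the colouring `c` itself.
    ≡⟨ cong (λ z → 2 ^ suc k * z + r) (sym (trans (𝟙-monochromatic c x) (∑-allFin-2+ 0 V))) ⟩
  2 ^ suc k * 𝟙 (monochromatic? c x) + r ∎
  where
  open ≡-Reasoning
  W : Fin (2 + r) → ℕ
  W j = ∏ (λ i → recolour-weight {r} (c (x i)) j)
  V : Fin 2 → ℕ
  V s = ∏ (λ i → 𝟙 (c (x i) ≟ᶠ s))
  old : ∀ s → W (s ↑ˡ r) ≡ 2 ^ suc k * V s
  old s = trans (∏-cong (λ i → recolour-weight-old {r} (c (x i)) s))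
      (∏-*ˡ 2 (λ i → 𝟙 (c (x i) ≟ᶠ s)))
  new : ∀ u → W (suc (suc u)) ≡ 1
  new u = trans (∏-cong (λ i → recolour-weight-new (c (x i)) u)) (∏-one (suc k))
  regroup : ∀ a b c d → a * b + (a * c + d) ≡ a * (b + (c + 0)) + d
  regroup = solve-∀

-- For each final colour the draws at the distinct coordinates are independent; the resulting
-- weights are then added over all final colours.
∑-recolouring : (c : Colouring 2 n) (x : Vector (Fin n) (suc k)) → Injective _≡_ _≡_ x →
  (2 + r) ^ suc k * ∑ (tuples n (2 + r)) (λ ρ → 𝟙 (monochromatic? (recolouring {r = r} c ρ) x)) ≡
  (2 ^ suc k * 𝟙 (monochromatic? c x) + r) * length (tuples n (2 + r))
∑-recolouring {n} {k} {r} c x inj = begin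
  (2 + r) ^ suc k * ∑ T (λ ρ → 𝟙 (monochromatic? (recolouring {r = r} c ρ) x))
    ≡⟨ cong ((2 + r) ^ suc k *_) (trans
        (∑-cong T λ ρ → 𝟙-monochromatic (recolouring {r = r} c ρ) x) (∑-swap T R _)) ⟩
  (2 + r) ^ suc k * ∑ R (λ j → ∑ T (λ ρ → ∏ (λ i → 𝟙 (recolour (c (x i)) (ρ (x i)) ≟ᶠ j))))
    ≡⟨ sym (∑-*ˡ R ((2 + r) ^ suc k) _) ⟩
  ∑ R (λ j → (2 + r) ^ suc k * ∑ T (λ ρ → ∏ (λ i → 𝟙 (recolour (c (x i)) (ρ (x i)) ≟ᶠ j))))
    ≡⟨ ∑-cong R (λ j → trans (∑-tuples-∏ x inj (λ i t → 𝟙 (recolour (c (x i)) t ≟ᶠ j)))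
        (*-comm (W j) (length T))) ⟩
  ∑ R (λ j → length T * W j)
    ≡⟨ trans (∑-*ˡ R (length T) W) (*-comm (length T) (∑ R W)) ⟩
  ∑ R W * length T
    ≡⟨ cong (_* length T) (∑-∏-recolour-weight {r = r} c x) ⟩
  (2 ^ suc k * 𝟙 (monochromatic? c x) + r) * length T ∎
  where
  open ≡-Reasoning
  R = allFin (2 + r)
  T = tuples n (2 + r)
  W : Fin (2 + r) → ℕ
  W j = ∏ (λ i → recolour-weight {r} (c (x i)) j)

-- At a degenerate tuple the trivial bound, one per draw, is charged to the last term.
∑-recolouring-≤ : (c : Colouring 2 n) (x : Vector (Fin n) (suc k)) →
  (2 + r) ^ suc k * ∑ (tuples n (2 + r)) (λ ρ → 𝟙 (monochromatic? (recolouring {r = r} c ρ) x)) ≤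
  length (tuples n (2 + r)) *
    (2 ^ suc k * 𝟙 (monochromatic? c x) + r + (2 + r) ^ suc k * 𝟙 (degenerate? x))
∑-recolouring-≤ {n} {k} {r} c x = cases (degenerate? x)
  where
  open ≤-Reasoning
  T = tuples n (2 + r)
  P = (2 + r) ^ suc k
  m = 2 ^ suc k * 𝟙 (monochromatic? c x) + r
  X = ∑ T (λ ρ → 𝟙 (monochromatic? (recolouring {r = r} c ρ) x))
  cases : (d : Dec (Degenerate x)) → P * X ≤ length T * (m + P * 𝟙 d)
  cases (no ¬deg) = begin
    P * X                  ≡⟨ ∑-recolouring {r = r} c x (¬degenerate⇒injective x ¬deg) ⟩
    m * length T           ≡⟨ *-comm m (length T) ⟩
    length T * m           ≤⟨ *-monoʳ-≤ (length T) (m≤m+n m (P * 0)) ⟩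
    length T * (m + P * 0) ∎
  cases (yes _) = begin
    P * X                  ≤⟨ *-monoʳ-≤ P
        (∑-mono T (λ ρ → 𝟙≤1 (monochromatic? (recolouring {r = r} c ρ) x))) ⟩
    P * ∑ T (λ _ → 1)      ≡⟨ cong (P *_) (∑-const T 1) ⟩
    P * (length T * 1)     ≡⟨ regroup P (length T) ⟩
    length T * (P * 1)     ≤⟨ *-monoʳ-≤ (length T) (m≤n+m (P * 1) m) ⟩
    length T * (m + P * 1) ∎
    where
    regroup : ∀ p t → p * (t * 1) ≡ t * (p * 1)
    regroup = solve-∀

-- Linearity of expectation: the sums over draws and over solutions are exchanged, and the bound at
-- a single solution is added up.
∑-#monochromatic : ∀ (a : Vector _ (suc k)) (c : Colouring 2 n) →
  (2 + r) ^ suc k * ∑ (tuples n (2 + r)) (λ ρ → #monochromatic a (recolouring {r = r} c ρ)) ≤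
  length (tuples n (2 + r)) *
    (2 ^ suc k * #monochromatic a c + r * #solutions a n + (2 + r) ^ suc k * #degenerate a n)
∑-#monochromatic {k} {n} {r} a c = begin
  P * ∑ T (λ ρ → #monochromatic a (recolouring {r = r} c ρ))
    ≡⟨ cong (P *_) (trans (∑-cong T
        (λ ρ → length-filter (monochromatic? (recolouring {r = r} c ρ)) S)) (∑-swap T S _)) ⟩
  P * ∑ S (λ x → ∑ T (λ ρ → 𝟙 (monochromatic? (recolouring {r = r} c ρ) x)))
    ≡⟨ sym (∑-*ˡ S P _) ⟩
  ∑ S (λ x → P * ∑ T (λ ρ → 𝟙 (monochromatic? (recolouring {r = r} c ρ) x)))
    ≤⟨ ∑-mono S (∑-recolouring-≤ {r = r} c) ⟩
  ∑ S (λ x → length T * (2 ^ suc k * 𝟙 (monochromatic? c x) + r + P * 𝟙 (degenerate? x)))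
    ≡⟨ ∑-*ˡ S (length T) (λ x → 2 ^ suc k * 𝟙 (monochromatic? c x) + r + P * 𝟙 (degenerate? x)) ⟩
  length T * ∑ S (λ x → 2 ^ suc k * 𝟙 (monochromatic? c x) + r + P * 𝟙 (degenerate? x))
    ≡⟨ cong (length T *_) (trans (∑-+ S (λ x → 2 ^ suc k * 𝟙 (monochromatic? c x) + r)
        (λ x → P * 𝟙 (degenerate? x)))
         (cong₂ _+_ (trans (∑-+ S (λ x → 2 ^ suc k * 𝟙 (monochromatic? c x)) (λ _ → r))
            (cong₂ _+_ (trans (∑-*ˡ S (2 ^ suc k) (λ x → 𝟙 (monochromatic? c x)))
                (cong (2 ^ suc k *_) (sym (length-filter (monochromatic? c) S))))
                       (trans (∑-const S r) (*-comm (length S) r))))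
            (trans (∑-*ˡ S P (λ x → 𝟙 (degenerate? x)))
                (cong (P *_) (sym (length-filter degenerate? S)))))) ⟩
  length T * (2 ^ suc k * #monochromatic a c + r * #solutions a n + P * #degenerate a n) ∎
  where
  open ≤-Reasoning
  T = tuples n (2 + r)
  S = solutions a n
  P = (2 + r) ^ suc k

-- Averaging the many-colour bound

length-tuples : ∀ k n → length (tuples k n) ≡ n ^ k
length-tuples zero    n = refl
length-tuples (suc k) n = begin
  length (tuples (suc k) n)                      ≡⟨ sym (length≡∑ (tuples (suc k) n)) ⟩
  ∑ (tuples (suc k) n) (λ _ → 1)                 ≡⟨ ∑-tuples k n (λ _ → 1) ⟩
  ∑ (allFin n) (λ _ → ∑ (tuples k n) (λ _ → 1))
      ≡⟨ ∑-cong (allFin n) (λ _ → trans (length≡∑ (tuples k n)) (length-tuples k n)) ⟩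
  ∑ (allFin n) (λ _ → n ^ k)                     ≡⟨ ∑-const (allFin n) (n ^ k) ⟩
  length (allFin n) * n ^ k                      ≡⟨ cong (_* n ^ k) (length-allFin n) ⟩
  n * n ^ k                                      ∎
  where
  open ≡-Reasoning
  length≡∑ : ∀ {A : Set} xs → ∑ {A} xs (λ _ → 1) ≡ length xs
  length≡∑ xs = trans (∑-const xs 1) (*-identityʳ (length xs))

-- The hypothesis is the common bound with error `1 / e`, cleared of denominators. It is summed over
-- all draws `ρ`, and their number `L` cancels.
recolouring-bound : ∀ (a : Vector _ (suc k)) (c : Colouring 2 n) e →
  (∀ ρ → #solutions a n * e ≤ (2 + r) ^ k *
      (#monochromatic a (recolouring {r = r} c ρ) * e + #solutions a n)) →
  (2 + r) * (#solutions a n * e) ≤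
    e * (2 ^ suc k * #monochromatic a c + r * #solutions a n + (2 + r) ^ suc k * #degenerate a n)
    + (2 + r) ^ suc k * #solutions a n
recolouring-bound {k} {n} {r} a c e common =
  *-cancelˡ-≤ L {{subst NonZero (sym (length-tuples n (2 + r))) (m^n≢0 (2 + r) n)}} (begin
  L * ((2 + r) * (S * e))
    ≡⟨ regroup₁ L (2 + r) (S * e) ⟩
  (2 + r) * (L * (S * e))
    ≡⟨ cong ((2 + r) *_) (sym (∑-const T (S * e))) ⟩
  (2 + r) * ∑ T (λ _ → S * e)
    ≤⟨ *-monoʳ-≤ (2 + r) (∑-mono T common) ⟩
  (2 + r) * ∑ T (λ ρ → (2 + r) ^ k * (M ρ * e + S))
    ≡⟨ cong ((2 + r) *_) (trans (∑-*ˡ T ((2 + r) ^ k) (λ ρ → M ρ * e + S)) (cong ((2 + r) ^ k *_)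
         (trans (∑-+ T (λ ρ → M ρ * e) (λ _ → S)) (cong₂ _+_
           (trans (∑-cong T (λ ρ → *-comm (M ρ) e)) (∑-*ˡ T e M)) (∑-const T S))))) ⟩
  (2 + r) * ((2 + r) ^ k * (e * ∑ T M + L * S))
    ≡⟨ regroup₂ (2 + r) ((2 + r) ^ k) e (∑ T M) (L * S) ⟩
  e * ((2 + r) ^ suc k * ∑ T M) + (2 + r) ^ suc k * (L * S)
    ≤⟨ +-monoˡ-≤ _ (*-monoʳ-≤ e (∑-#monochromatic {r = r} a c)) ⟩
  e * (L * total) + (2 + r) ^ suc k * (L * S)
    ≡⟨ regroup₃ e L total ((2 + r) ^ suc k) S ⟩
  L * (e * total + (2 + r) ^ suc k * S) ∎)
  where
  open ≤-Reasoning
  T = tuples n (2 + r)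
  L = length T
  S = #solutions a n
  M : Vector (Fin (2 + r)) n → ℕ
  M ρ = #monochromatic a (recolouring {r = r} c ρ)
  total = 2 ^ suc k * #monochromatic a c + r * S + (2 + r) ^ suc k * #degenerate a n
  regroup₁ : ∀ l r s → l * (r * s) ≡ r * (l * s)
  regroup₁ = solve-∀
  regroup₂ : ∀ r p e m s → r * (p * (e * m + s)) ≡ e * (r * p * m) + r * p * s
  regroup₂ = solve-∀
  regroup₃ : ∀ e l b p s → e * (l * b) + p * (l * s) ≡ l * (e * b + p * s)
  regroup₃ = solve-∀

-- After division by `P` the tolerance costs one `S`, and by `few` the degenerate solutions cost
-- another; both fit into the `2 * q * S` that the doubled conclusion allows. The contribution
-- `r * (S * e)` of the new colours stands on both sides and cancels.
two-colour-bound : ∀ S M D P q r e .{{_ : NonZero P}} .{{_ : NonZero q}} →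
  (2 + r) * (S * (P * e)) ≤ P * e * (2 * q * M + r * S + P * D) + P * S →
  e * P * D ≤ S →
  S * e ≤ q * (M * e + S)
two-colour-bound S M D P q r e bound few = *-cancelˡ-≤ 2 (+-cancelʳ-≤ (r * (S * e)) _ _ (begin
  2 * (S * e) + r * (S * e)
    ≡⟨ sym (*-distribʳ-+ (S * e) 2 r) ⟩
  (2 + r) * (S * e)
    ≤⟨ *-cancelˡ-≤ P (≤-trans (≤-reflexive (regroup₁ P (2 + r) S e))
        (≤-trans bound (≤-reflexive (regroup₂ P e q M r S D)))) ⟩
  e * (2 * q * M) + r * (S * e) + e * P * D + S
    ≤⟨ +-mono-≤ (+-monoʳ-≤ (e * (2 * q * M) + r * (S * e)) (≤-trans few (m≤n*m S q))) (m≤n*m S q) ⟩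
  e * (2 * q * M) + r * (S * e) + q * S + q * S
    ≡⟨ regroup₃ q e M r S ⟩
  2 * (q * (M * e + S)) + r * (S * e) ∎))
  where
  open ≤-Reasoning
  regroup₁ : ∀ p r s e → p * (r * (s * e)) ≡ r * (s * (p * e))
  regroup₁ = solve-∀
  regroup₂ : ∀ p e q m r s d → p * e * (2 * q * m + r * s + p * d) + p * s ≡
             p * (e * (2 * q * m) + r * (s * e) + e * p * d + s)
  regroup₂ = solve-∀
  regroup₃ : ∀ q e m r s → e * (2 * q * m) + r * (s * e) + q * s + q * s ≡
             2 * (q * (m * e + s)) + r * (s * e)
  regroup₃ = solve-∀

-- Rational bounds with cleared denominators

≤+⇒-≤ : ∀ {p q t} → p ℚ.≤ t ℚ.+ q → p ℚ.- q ℚ.≤ t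
≤+⇒-≤ {p} {q} {t} p≤t+q = begin
  p ℚ.- q             ≤⟨ ℚ.+-monoˡ-≤ (ℚ.- q) p≤t+q ⟩
  t ℚ.+ q ℚ.- q       ≃⟨ ℚ.+-assoc t q (ℚ.- q) ⟩
  t ℚ.+ (q ℚ.- q)     ≃⟨ ℚ.+-congʳ t (ℚ.+-inverseʳ q) ⟩
  t ℚ.+ 0ℚᵘ           ≃⟨ ℚ.+-identityʳ t ⟩
  t                   ∎
  where open ℚ.≤-Reasoning

-≤⇒≤+ : ∀ {p q t} → p ℚ.- q ℚ.≤ t → p ℚ.≤ t ℚ.+ q
-≤⇒≤+ {p} {q} {t} p-q≤t = begin
  p                       ≃⟨ ℚ.+-identityʳ p ⟨
  p ℚ.+ 0ℚᵘ               ≃⟨ ℚ.+-congʳ p (ℚ.+-inverseˡ q) ⟨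
  p ℚ.+ (ℚ.- q ℚ.+ q)     ≃⟨ ℚ.+-assoc p (ℚ.- q) q ⟨
  p ℚ.- q ℚ.+ q           ≤⟨ ℚ.+-monoˡ-≤ q p-q≤t ⟩
  t ℚ.+ q                 ∎
  where open ℚ.≤-Reasoning

-- The left side is what appears when `+ 1 / P ℚ.≤ + M / S ℚ.+ + 1 / e` is unfolded into its
-- cross-multiplied form.
fraction-bound-numerator : ∀ M S P e →
  (+ M ℤ.* + e ℤ.+ + 1 ℤ.* + S) ℤ.* + P ≡ + (P * (M * e + S))
fraction-bound-numerator M S P e = begin
  (+ M ℤ.* + e ℤ.+ + 1 ℤ.* + S) ℤ.* + P
    ≡⟨ cong (ℤ._* + P) (cong₂ ℤ._+_ (sym (ℤ.pos-* M e)) (ℤ.*-identityˡ (+ S))) ⟩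
  (+ (M * e) ℤ.+ + S) ℤ.* + P
    ≡⟨ cong (ℤ._* + P) (sym (ℤ.pos-+ (M * e) S)) ⟩
  + (M * e + S) ℤ.* + P
    ≡⟨ sym (ℤ.pos-* (M * e + S) P) ⟩
  + ((M * e + S) * P)
    ≡⟨ cong +_ (*-comm (M * e + S) P) ⟩
  + (P * (M * e + S)) ∎
  where open ≡-Reasoning

fraction-bound⁻ : ∀ M S P e .{{_ : NonZero S}} .{{_ : NonZero P}} .{{_ : NonZero e}} →
  (+ 1 / P) ℚ.- (+ 1 / e) ℚ.≤ + M / S → S * e ≤ P * (M * e + S)
-- Exposing the denominators as successors lets `_/_` compute.
fraction-bound⁻ M S@(suc _) P@(suc _) e@(suc _) bound
  with -≤⇒≤+ {+ 1 / P} {+ 1 / e} {+ M / S} bound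
... | *≤* le = ℤ.drop‿+≤+
  (subst₂ ℤ._≤_ (ℤ.*-identityˡ (+ (S * e))) (fraction-bound-numerator M S P e) le)

fraction-bound⁺ : ∀ M S P e .{{_ : NonZero S}} .{{_ : NonZero P}} .{{_ : NonZero e}} →
  S * e ≤ P * (M * e + S) → (+ 1 / P) ℚ.- (+ 1 / e) ℚ.≤ + M / S
fraction-bound⁺ M S@(suc _) P@(suc _) e@(suc _) le = ≤+⇒-≤ {+ 1 / P} {+ 1 / e} {+ M / S}
  (*≤* (subst₂ ℤ._≤_ (sym (ℤ.*-identityˡ (+ (S * e)))) (sym (fraction-bound-numerator M S P e))
    (+≤+ le)))

-- A positive fraction has numerator at least 1. Hence it suffices to treat errors of the form
-- `+ 1 / e`.
1/↧≤ : ∀ {ε} → 0ℚᵘ ℚ.< ε → + 1 / ↧ₙ ε ℚ.≤ ε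
1/↧≤ {mkℚᵘ (+ suc m) d} _ = *≤* (+≤+ (*-monoˡ-≤ (suc d) (s≤s (z≤n {m}))))
1/↧≤ {mkℚᵘ (+ zero) d} (*<* (ℤ.+<+ ()))
1/↧≤ {mkℚᵘ (ℤ.-[1+ m ]) d} (*<* ())

0<1/ : ∀ e .{{_ : NonZero e}} → 0ℚᵘ ℚ.< + 1 / e
0<1/ (suc e) = *<* (ℤ.+<+ (s≤s z≤n))

≤-weaken-ε : ∀ {p δ ε t} → δ ℚ.≤ ε → p ℚ.- δ ℚ.≤ t → p ℚ.- ε ℚ.≤ t
≤-weaken-ε {p} δ≤ε = ℚ.≤-trans (ℚ.+-monoʳ-≤ p (ℚ.neg-mono-≤ δ≤ε))

-- Counting solutions

-- Tuples are functions, so membership and uniqueness in lists of them are taken up to pointwise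
-- equality.
tupleSetoid : ℕ → ℕ → Setoid _ _
tupleSetoid k n = Fin k →-setoid Fin n

tuples-complete : ∀ (x : Vector (Fin n) k) → Any (x ≗_) (tuples k n)
tuples-complete {n} {zero}  x = here λ ()
tuples-complete {n} {suc k} x = Any.map (λ eq → λ { zero → eq zero ; (suc i) → eq (suc i) })
  (Any.map (λ eq → λ i → trans (split i) (eq i))
   (Membership.∈-cartesianProductWith⁺ (setoid (Fin n)) (tupleSetoid k n) (tupleSetoid (suc k) n)
    {f = Vector._∷_} (λ { refl eq zero → refl ; refl eq (suc i) → eq i })
    (∈.∈-allFin (x zero)) (tuples-complete (x ∘ suc))))
  where
  split : x ≗ (x zero Vector.∷ x ∘ suc)
  split zero    = refl
  split (suc i) = refl

tuples-unique : ∀ k n → Unique.Unique (tupleSetoid k n) (tuples k n)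
tuples-unique zero    n = [] ∷ []
tuples-unique (suc k) n =
  Unique.cartesianProductWith⁺ (setoid (Fin n)) (tupleSetoid k n) (tupleSetoid (suc k) n)
    Vector._∷_ (λ eq → eq zero , eq ∘ suc) (≡Unique.allFin⁺ n) (tuples-unique k n)

lookup-injective : ∀ {c ℓ} (S : Setoid c ℓ) {xs} → Unique.Unique S xs →
                   ∀ {i j} → Setoid._≈_ S (lookup xs i) (lookup xs j) → i ≡ j
lookup-injective S (x∉ ∷ u) {zero}  {zero}  eq = refl
lookup-injective S (x∉ ∷ u) {zero}  {suc j} eq = contradiction eq (All.lookup x∉ (∈.∈-lookup j))
lookup-injective S (x∉ ∷ u) {suc i} {zero}  eq = contradiction (Setoid.sym S eq)
  (All.lookup x∉ (∈.∈-lookup i))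
lookup-injective S (x∉ ∷ u) {suc i} {suc j} eq = cong suc (lookup-injective S u eq)

IsSolution-resp : ∀ (a : Vector ℤ k) {x y : Vector (Fin n) k} → x ≗ y →
                  IsSolution a x → IsSolution a y
IsSolution-resp a eq = trans (sum-cong-≗ (λ i → cong (λ z → a i ℤ.* value z) (sym (eq i))))

solutions-complete : ∀ (a : Vector ℤ k) {x : Vector (Fin n) k} →
                     IsSolution a x → Any (x ≗_) (solutions a n)
solutions-complete {k} {n} a {x} sol =
  Membership.∈-filter⁺ (tupleSetoid k n) (isSolution? a) (IsSolution-resp a) (tuples-complete x) sol

remQuot-injective : ∀ {m} n {i j : Fin (m * n)} → remQuot {m} n i ≡ remQuot n j → i ≡ j
remQuot-injective {m} n {i} {j} eq =
  trans (sym (combine-remQuot {m} n i))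
      (trans (cong (λ (q , r) → combine q r) eq) (combine-remQuot {m} n j))

injective₂⇒≤ : ∀ {a b c} (f : Fin a → Fin b → Fin c) →
  (∀ {i i′ j j′} → f i j ≡ f i′ j′ → i ≡ i′ × j ≡ j′) → a * b ≤ c
injective₂⇒≤ {a} {b} f inj = injective⇒≤
  {f = λ p → f (proj₁ (remQuot {a} b p)) (proj₂ (remQuot {a} b p))}
  λ eq → let (eq₁ , eq₂) = inj eq in remQuot-injective {a} b (cong₂ _,_ eq₁ eq₂)

funToFin-injective : {x y : Vector (Fin n) k} → funToFin x ≡ funToFin y → x ≗ y
funToFin-injective {x = x} {y} eq i =
  trans (sym (finToFun-funToFin x i)) (trans (cong (λ p → finToFun p i) eq) (finToFun-funToFin y i))

funToFin-cong : {x y : Vector (Fin n) k} → x ≗ y → funToFin x ≡ funToFin y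
funToFin-cong {k = zero}  eq = refl
funToFin-cong {k = suc k} eq = cong₂ combine (eq zero) (funToFin-cong (eq ∘ suc))

finToFun-injective : {p q : Fin (n ^ k)} → finToFun {n} {k} p ≗ finToFun q → p ≡ q
finToFun-injective {n} {k} {p} {q} eq =
  trans (sym (funToFin-finToFin {k} {n} p)) (trans (funToFin-cong eq) (funToFin-finToFin {k} {n} q))

value-injective : {i j : Fin n} → value i ≡ value j → i ≡ j
value-injective eq = toℕ-injective (ℕ.suc-injective (ℤ.+-injective eq))

-- Upper bound for degenerate solutions

-- The equation can be solved for coordinate `l`: all other terms of the two sums agree and cancel,
-- and then so does the non-zero `a l`.
solution-determined : ∀ (a : Vector ℤ (suc k)) l → a l ≢ 0ℤ → {x y : Vector (Fin n) (suc k)} →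
  IsSolution a x → IsSolution a y → (∀ i → i ≢ l → x i ≡ y i) → x l ≡ y l
solution-determined {k} {n} a l al≢0 {x} {y} solx soly agree =
  value-injective (ℤ.*-cancelˡ-≡ (a l) (value (x l)) (value (y l)) {{ℤ.≢-nonZero al≢0}}
    (∙-cancelʳ (rest x) _ _ (begin
      term x l ℤ.+ rest x ≡⟨ sym (sum-remove {i = l} (term x)) ⟩
      sum (term x)        ≡⟨ trans solx (sym soly) ⟩
      sum (term y)        ≡⟨ sum-remove {i = l} (term y) ⟩
      term y l ℤ.+ rest y ≡⟨ cong (λ z → term y l ℤ.+ z)
          (sum-cong-≗ λ i → cong (λ z → a (punchIn l i) ℤ.* value z)
              (sym (agree (punchIn l i) (punchInᵢ≢i l i)))) ⟩
      term y l ℤ.+ rest x ∎)))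
  where
  open ≡-Reasoning
  term : Vector (Fin n) (suc k) → Vector ℤ (suc k)
  term x i = a i ℤ.* value (x i)
  rest : Vector (Fin n) (suc k) → ℤ
  rest x = sum (Vector.removeAt (term x) l)

-- Here three variables are needed: besides the repeated pair there must be a coordinate left to
-- recover from the equation.
third-index : ∀ (i j : Fin (3 + k)) → ∃ λ l → l ≢ i × l ≢ j
third-index zero          zero          = suc zero , (λ ()) , λ ()
third-index zero          (suc zero)    = suc (suc zero) , (λ ()) , λ ()
third-index zero          (suc (suc j)) = suc zero , (λ ()) , λ ()
third-index (suc zero)    zero          = suc (suc zero) , (λ ()) , λ ()
third-index (suc (suc i)) zero          = suc zero , (λ ()) , λ ()
third-index (suc i)       (suc j)       = zero , (λ ()) , λ ()

agree-by-cases : ∀ {A : Set} {x y : Vector A k} {i j} → x j ≡ y j → (i ≢ j → x i ≡ y i) → x i ≡ y i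
agree-by-cases {i = i} {j} at off with i ≟ᶠ j
... | yes refl = at
... | no i≢j   = off i≢j

_[_≔_] : {A : Set} → Vector A k → Fin k → A → Vector A k
x [ i ≔ s ] = Vector.updateAt x i (λ _ → s)

-- A degenerate solution with xᵢ = xⱼ is determined by its coordinates other than xⱼ and xₗ,
-- for any third index l.
#degenerate-bound : ∀ (a : Vector ℤ (3 + k)) → (∀ i → a i ≢ 0ℤ) → ∀ n →
  n * n * #degenerate a n ≤ (3 + k) * (3 + k) * n ^ (3 + k)
#degenerate-bound {k} a a≢0 n = injective₂⇒≤ code code-injective
  where
  K = 3 + k
  degenerates = filter degenerate? (solutions a n)
  x : Fin (length degenerates) → Vector (Fin n) K
  x d = lookup degenerates d
  x∈ : ∀ d → x d ∈ solutions a n × Degenerate (x d)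
  x∈ d = ∈.∈-filter⁻ degenerate? (∈.∈-lookup d)
  solution : ∀ d → IsSolution a (x d)
  solution d = proj₂ (∈.∈-filter⁻ (isSolution? a) {xs = tuples K n} (proj₁ (x∈ d)))
  fst snd thd : Fin (length degenerates) → Fin K
  fst d = proj₁ (proj₂ (x∈ d))
  snd d = proj₁ (proj₂ (proj₂ (x∈ d)))
  thd d = proj₁ (third-index (fst d) (snd d))
  fst≢snd : ∀ d → fst d ≢ snd d
  fst≢snd d = proj₁ (proj₂ (proj₂ (proj₂ (x∈ d))))
  x-fst≡x-snd : ∀ d → x d (fst d) ≡ x d (snd d)
  x-fst≡x-snd d = proj₂ (proj₂ (proj₂ (proj₂ (x∈ d))))
  thd≢fst : ∀ d → thd d ≢ fst d
  thd≢fst d = proj₁ (proj₂ (third-index (fst d) (snd d)))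
  thd≢snd : ∀ d → thd d ≢ snd d
  thd≢snd d = proj₂ (proj₂ (third-index (fst d) (snd d)))

  -- The entries at `snd d` and `thd d` can be reconstructed, so their slots are free to store `s`
  -- and `t`. This gives the factor `n * n` in the bound.
  y : Fin n → Fin n → Fin (length degenerates) → Vector (Fin n) K
  y s t d = (x d [ snd d ≔ s ]) [ thd d ≔ t ]
  y-thd : ∀ s t d → y s t d (thd d) ≡ t
  y-thd s t d = updateAt-updates (thd d) _
  y-snd : ∀ s t d → y s t d (snd d) ≡ s
  y-snd s t d = trans (updateAt-minimal (snd d) (thd d) _ (≢-sym (thd≢snd d)))
      (updateAt-updates (snd d) _)
  y-other : ∀ s t d i → i ≢ snd d → i ≢ thd d → y s t d i ≡ x d i
  y-other s t d i i≢snd i≢thd =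
    trans (updateAt-minimal i (thd d) _ i≢thd) (updateAt-minimal i (snd d) _ i≢snd)

  -- The code records `fst d` and `snd d`, which also determine `thd d`, so the overwritten slots
  -- are known.
  code : Fin (n * n) → Fin (length degenerates) → Fin (K * K * n ^ K)
  code p d = combine (combine (fst d) (snd d))
      (funToFin (y (proj₁ (remQuot {n} n p)) (proj₂ (remQuot {n} n p)) d))

  y-injective : ∀ {s s′ t t′ d d′} → fst d ≡ fst d′ → snd d ≡ snd d′ → y s t d ≗ y s′ t′ d′ →
                s ≡ s′ × t ≡ t′ × x d ≗ x d′
  y-injective {s} {s′} {t} {t′} {d} {d′} fst≡ snd≡ y≡ =
    trans (sym (y-snd s t d)) (trans (y≡ (snd d))
        (trans (cong (y s′ t′ d′) snd≡) (y-snd s′ t′ d′))) ,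
    trans (sym (y-thd s t d)) (trans (y≡ (thd d))
        (trans (cong (y s′ t′ d′) thd≡) (y-thd s′ t′ d′))) ,
    x≡
    where
    thd≡ : thd d ≡ thd d′
    thd≡ = cong₂ (λ i j → proj₁ (third-index i j)) fst≡ snd≡
    other : ∀ i → i ≢ snd d → i ≢ thd d → x d i ≡ x d′ i
    other i i≢snd i≢thd = trans (sym (y-other s t d i i≢snd i≢thd)) (trans (y≡ i)
      (y-other s′ t′ d′ i (λ e → i≢snd (trans e (sym snd≡))) (λ e → i≢thd (trans e (sym thd≡)))))
    at-snd : x d (snd d) ≡ x d′ (snd d)
    at-snd = begin
      x d (snd d)    ≡⟨ sym (x-fst≡x-snd d) ⟩
      x d (fst d)    ≡⟨ other (fst d) (fst≢snd d) (≢-sym (thd≢fst d)) ⟩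
      x d′ (fst d)   ≡⟨ cong (x d′) fst≡ ⟩
      x d′ (fst d′)  ≡⟨ x-fst≡x-snd d′ ⟩
      x d′ (snd d′)  ≡⟨ cong (x d′) (sym snd≡) ⟩
      x d′ (snd d)   ∎
      where open ≡-Reasoning
    off-thd : ∀ i → i ≢ thd d → x d i ≡ x d′ i
    off-thd i i≢thd = agree-by-cases at-snd (λ i≢snd → other i i≢snd i≢thd)
    x≡ : x d ≗ x d′
    x≡ i = agree-by-cases
      (solution-determined a (thd d) (a≢0 (thd d)) (solution d) (solution d′) off-thd) (off-thd i)

  code-injective : ∀ {p p′ d d′} → code p d ≡ code p′ d′ → p ≡ p′ × d ≡ d′
  code-injective {p} {p′} {d} {d′} eq =
    let ij≡ , y≡ = combine-injective (combine (fst d) (snd d)) _ (combine (fst d′) (snd d′)) _ eq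
        fst≡ , snd≡ = combine-injective (fst d) (snd d) (fst d′) (snd d′) ij≡
        s≡ , t≡ , x≡ = y-injective {d = d} {d′} fst≡ snd≡ (funToFin-injective y≡)
    in remQuot-injective {n} n (cong₂ _,_ s≡ t≡) ,
       lookup-injective (tupleSetoid K n)
         (Unique.filter⁺ (tupleSetoid K n) degenerate?
             (Unique.filter⁺ (tupleSetoid K n) (isSolution? a) (tuples-unique K n)))
         x≡

-- Lower bound for all solutions

positive-shift : ∀ W δ → ∣ δ ∣ < W → ∃ λ j → + W ℤ.+ δ ≡ + suc j × suc j ≤ W + ∣ δ ∣
positive-shift (suc w) (+ d)    _   = w + d , refl , ≤-refl
positive-shift (suc w) -[1+ d ] d<w = w ∸ suc d , trans (ℤ.⊖-≥ d<w′) (cong +_ (+-∸-assoc 1 d<w″)) ,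
                                      s≤s (≤-trans (m∸n≤m w (suc d)) (m≤m+n w (suc d)))
  where
  d<w′ : suc d ≤ suc w
  d<w′ = <⇒≤ d<w
  d<w″ : suc d ≤ w
  d<w″ = s≤s⁻¹ d<w

-- Since `value v` lies between 1 and `n₀`, a shift smaller than `W` keeps the dilated value above 0
-- and below `W * suc n₀`.
value-shift : ∀ {n₀} W δ (v : Fin n₀) → ∣ δ ∣ < W → W * suc n₀ ≤ n →
              ∃ λ (x : Fin n) → value x ≡ + W ℤ.* value v ℤ.+ δ
value-shift {n} {n₀} W δ v δ<W W≤n with positive-shift W δ δ<W
... | j , W+δ≡ , j≤ = fromℕ< in-range , (begin
  + suc (toℕ (fromℕ< in-range))        ≡⟨ cong (λ z → + suc z) (toℕ-fromℕ< in-range) ⟩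
  + suc (W * t + j)                    ≡⟨ cong +_ (sym (+-suc (W * t) j)) ⟩
  + (W * t + suc j)                    ≡⟨ ℤ.pos-+ (W * t) (suc j) ⟩
  + (W * t) ℤ.+ + suc j                ≡⟨ cong₂ ℤ._+_ (ℤ.pos-* W t) (sym W+δ≡) ⟩
  + W ℤ.* + t ℤ.+ (+ W ℤ.+ δ)          ≡⟨ regroup (+ W) (+ t) δ ⟩
  + W ℤ.* (+ 1 ℤ.+ + t) ℤ.+ δ          ∎)
  where
  open ≡-Reasoning
  t = toℕ v
  regroup : ∀ w t d → w ℤ.* t ℤ.+ (w ℤ.+ d) ≡ w ℤ.* (+ 1 ℤ.+ t) ℤ.+ d
  regroup = ℤ-solve-∀
  in-range : W * t + j < n
  in-range = ≤-trans (≤-reflexive (sym (+-suc (W * t) j)))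
      (≤-trans (+-monoʳ-≤ (W * t) (≤-trans j≤ (+-monoʳ-≤ W (<⇒≤ δ<W))))
    (≤-trans (≤-reflexive (regroup′ W t)) (≤-trans (*-monoʳ-≤ W (s≤s (toℕ<n v))) W≤n)))
    where
    regroup′ : ∀ w t → w * t + (w + w) ≡ w * (2 + t)
    regroup′ = solve-∀

∣sum∣≤ : ∀ (a : Vector ℤ k) {M} (z : Vector (Fin M) k) →
         ∣ sum (λ i → a i ℤ.* value (z i)) ∣ ≤ sumℕ (∣_∣ ∘ a) * M
∣sum∣≤ {zero}  a     z = z≤n
∣sum∣≤ {suc k} a {M} z = begin
  ∣ a zero ℤ.* value (z zero) ℤ.+ σ ∣      ≤⟨ ℤ.∣i+j∣≤∣i∣+∣j∣ (a zero ℤ.* value (z zero)) σ ⟩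
  ∣ a zero ℤ.* value (z zero) ∣ + ∣ σ ∣    ≡⟨ cong (_+ ∣ σ ∣) (ℤ.abs-* (a zero) (value (z zero))) ⟩
  ∣ a zero ∣ * suc (toℕ (z zero)) + ∣ σ ∣
      ≤⟨ +-mono-≤ (*-monoʳ-≤ ∣ a zero ∣ (toℕ<n (z zero))) (∣sum∣≤ (a ∘ suc) (z ∘ suc)) ⟩
  ∣ a zero ∣ * M + L * M                   ≡⟨ sym (*-distribʳ-+ M ∣ a zero ∣ L) ⟩
  (∣ a zero ∣ + L) * M                     ∎
  where
  open ≤-Reasoning
  σ = sum (λ i → a (suc i) ℤ.* value (z (suc i)))
  L = sumℕ (λ i → ∣ a (suc i) ∣)

-- The lattice of integer solutions contains a₀ eᵢ − aᵢ e₀ for every i ≥ 1; adding small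
-- combinations of these to W v stays inside [n]^(k+1).
#solutions-bound : ∀ (a : Vector ℤ (suc k)) → a zero ≢ 0ℤ →
  ∀ {n₀} (v : Vector (Fin n₀) (suc k)) → IsSolution a v →
  ∀ M .{{_ : NonZero M}} → suc (sumℕ (∣_∣ ∘ a)) * M * suc n₀ ≤ n → M ^ k ≤ #solutions a n
#solutions-bound {k} {n} a a₀≢0 {n₀} v sol M W≤n = injective⇒≤ {f = λ p → index (finToFun p)} λ eq →
  finToFun-injective {M} {k} (index-injective eq)
  where
  L = sumℕ (∣_∣ ∘ a)
  -- Perturbations have size at most `L * M`; the extra `M`, which is positive, makes the inequality
  -- strict.
  W = suc L * M

  -- This is the lattice combination in which the generator a₀ eᵢ - aᵢ e₀ has coefficient
  -- `value (z i)`.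
  perturbation : Vector (Fin M) k → Vector ℤ (suc k)
  perturbation z zero    = ℤ.- sum (λ i → a (suc i) ℤ.* value (z i))
  perturbation z (suc i) = a zero ℤ.* value (z i)

  perturbation-small : ∀ z i → ∣ perturbation z i ∣ < W
  perturbation-small z i = ≤-<-trans (bound i) (m<n+m (L * M) (>-nonZero⁻¹ M))
    where
    open ≤-Reasoning
    ∣a∣≤L : ∀ {k} (a : Vector ℤ k) i → ∣ a i ∣ ≤ sumℕ (∣_∣ ∘ a)
    ∣a∣≤L a zero    = m≤m+n _ _
    ∣a∣≤L a (suc i) = ≤-trans (∣a∣≤L (a ∘ suc) i) (m≤n+m _ _)
    bound : ∀ i → ∣ perturbation z i ∣ ≤ L * M
    bound zero = begin
      ∣ ℤ.- σ ∣                      ≡⟨ ℤ.∣-i∣≡∣i∣ σ ⟩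
      ∣ σ ∣                          ≤⟨ ∣sum∣≤ (a ∘ suc) z ⟩
      sumℕ (∣_∣ ∘ a ∘ suc) * M       ≤⟨ *-monoˡ-≤ M (m≤n+m _ ∣ a zero ∣) ⟩
      L * M                          ∎
      where σ = sum (λ i → a (suc i) ℤ.* value (z i))
    bound (suc i) = begin
      ∣ a zero ℤ.* value (z i) ∣     ≡⟨ ℤ.abs-* (a zero) (value (z i)) ⟩
      ∣ a zero ∣ * suc (toℕ (z i))   ≤⟨ *-mono-≤ (∣a∣≤L a zero) (toℕ<n (z i)) ⟩
      L * M                          ∎

  perturbation-solution : ∀ z → sum (λ i → a i ℤ.* perturbation z i) ≡ 0ℤ
  perturbation-solution z = begin
    a zero ℤ.* (ℤ.- σ) ℤ.+ sum (λ i → a (suc i) ℤ.* (a zero ℤ.* value (z i)))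
      ≡⟨ cong (λ s → a zero ℤ.* (ℤ.- σ) ℤ.+ s)
          (sum-cong-≗ λ i → swap (a (suc i)) (a zero) (value (z i))) ⟩
    a zero ℤ.* (ℤ.- σ) ℤ.+ sum (λ i → a zero ℤ.* (a (suc i) ℤ.* value (z i)))
      ≡⟨ cong (λ s → a zero ℤ.* (ℤ.- σ) ℤ.+ s)
          (sym (*-distribˡ-sum (a zero) (λ i → a (suc i) ℤ.* value (z i)))) ⟩
    a zero ℤ.* (ℤ.- σ) ℤ.+ a zero ℤ.* σ
      ≡⟨ cancel (a zero) σ ⟩
    0ℤ ∎
    where
    open ≡-Reasoning
    σ = sum (λ i → a (suc i) ℤ.* value (z i))
    swap : ∀ x y z → x ℤ.* (y ℤ.* z) ≡ y ℤ.* (x ℤ.* z)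
    swap = ℤ-solve-∀
    cancel : ∀ x y → x ℤ.* (ℤ.- y) ℤ.+ x ℤ.* y ≡ 0ℤ
    cancel = ℤ-solve-∀

  perturbed : Vector (Fin M) k → Vector (Fin n) (suc k)
  perturbed z i = proj₁ (value-shift W (perturbation z i) (v i) (perturbation-small z i) W≤n)

  value-perturbed : ∀ z i → value (perturbed z i) ≡ + W ℤ.* value (v i) ℤ.+ perturbation z i
  value-perturbed z i = proj₂ (value-shift W (perturbation z i) (v i) (perturbation-small z i) W≤n)

  perturbed-solution : ∀ z → IsSolution a (perturbed z)
  perturbed-solution z = begin
    sum (λ i → a i ℤ.* value (perturbed z i))
      ≡⟨ sum-cong-≗ (λ i → trans (cong (λ y → a i ℤ.* y) (value-perturbed z i))
          (distribute (a i) (+ W) (value (v i)) (perturbation z i))) ⟩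
    sum (λ i → + W ℤ.* (a i ℤ.* value (v i)) ℤ.+ a i ℤ.* perturbation z i)
      ≡⟨ ∑-distrib-+ (λ i → + W ℤ.* (a i ℤ.* value (v i))) (λ i → a i ℤ.* perturbation z i) ⟩
    sum (λ i → + W ℤ.* (a i ℤ.* value (v i))) ℤ.+ sum (λ i → a i ℤ.* perturbation z i)
      ≡⟨ cong₂ ℤ._+_ (trans (sym (*-distribˡ-sum (+ W) (λ i → a i ℤ.* value (v i))))
          (cong (λ s → + W ℤ.* s) sol)) (perturbation-solution z) ⟩
    + W ℤ.* 0ℤ ℤ.+ 0ℤ
      ≡⟨ trans (ℤ.+-identityʳ (+ W ℤ.* 0ℤ)) (ℤ.*-zeroʳ (+ W)) ⟩
    0ℤ ∎
    where
    open ≡-Reasoning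
    distribute : ∀ a w v d → a ℤ.* (w ℤ.* v ℤ.+ d) ≡ w ℤ.* (a ℤ.* v) ℤ.+ a ℤ.* d
    distribute = ℤ-solve-∀

  -- The coordinates after the first already determine `z`, because there the perturbation is a
  -- non-zero multiple of `value (z i)`.
  perturbed-injective : ∀ {z z′} → perturbed z ≗ perturbed z′ → z ≗ z′
  perturbed-injective {z} {z′} eq i = value-injective
    (ℤ.*-cancelˡ-≡ (a zero) (value (z i)) (value (z′ i)) {{ℤ.≢-nonZero a₀≢0}}
      (∙-cancelˡ (+ W ℤ.* value (v (suc i))) _ _
        (trans (sym (value-perturbed z (suc i)))
            (trans (cong value (eq (suc i))) (value-perturbed z′ (suc i))))))

  member : ∀ z → Any (perturbed z ≗_) (solutions a n)
  member z = solutions-complete a (perturbed-solution z)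

  index : Vector (Fin M) k → Fin (#solutions a n)
  index z = Any.index (member z)

  index-injective : ∀ {z z′} → index z ≡ index z′ → z ≗ z′
  index-injective {z} {z′} eq =
    perturbed-injective
      (Membership.index-injective (tupleSetoid (suc k) n) (member z) (member z′) eq)

-- Degenerate solutions are negligible

^-distribʳ-* : ∀ k m n → (m * n) ^ k ≡ m ^ k * n ^ k
^-distribʳ-* zero    m n = refl
^-distribʳ-* (suc k) m n = trans (cong (m * n *_) (^-distribʳ-* k m n))
  (*-interchange m n (m ^ k) (n ^ k))

-- The number of degenerate solutions has order at most n^(k+1), whereas the total has order at
-- least n^(k+2), so their ratio falls below any fixed `1 / q`.
few-degenerate : ∀ (a : Vector ℤ (3 + k)) → (∀ i → a i ≢ 0ℤ) →
  ∀ {n₀} (v : Vector (Fin n₀) (3 + k)) → IsSolution a v →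
  ∀ q → ∃ λ N → ∀ n → N ≤ n → q * #degenerate a n ≤ #solutions a n
-- The summand `C` makes the quotient `M` positive, and `K * q` turns `n * D ≤ K * S` into
-- `q * D ≤ S`.
few-degenerate {k} a a≢0 {n₀} v sol q = C + K * q , bound
  where
  -- Perturbing with parameter `M` takes room `C * M`, so `M` is chosen as the integer quotient of
  -- `n` by `C`.
  C = suc (sumℕ (∣_∣ ∘ a)) * suc n₀
  K = (3 + k) * (3 + k) * (2 * C) ^ (2 + k)

  module _ (n : ℕ) (N≤n : C + K * q ≤ n) where
    open ≤-Reasoning
    M = n ℕ./ C
    D = #degenerate a n
    S = #solutions a n

    C≤n : C ≤ n
    C≤n = m+n≤o⇒m≤o C N≤n

    0<M : 0 < M
    0<M = m≥n⇒m/n>0 C≤n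

    -- Rounding down loses less than `C`, and `C ≤ M * C` because `M` is positive.
    n≤2CM : n ≤ 2 * C * M
    n≤2CM = begin
      n                  ≡⟨ m≡m%n+[m/n]*n n C ⟩
      n ℕ.% C + M * C    ≤⟨ +-monoˡ-≤ (M * C) (<⇒≤ (m%n<n n C)) ⟩
      C + M * C          ≤⟨ +-monoˡ-≤ (M * C) (m≤n*m C M {{>-nonZero 0<M}}) ⟩
      M * C + M * C      ≡⟨ regroup M C ⟩
      2 * C * M          ∎
      where
      regroup : ∀ m c → m * c + m * c ≡ 2 * c * m
      regroup = solve-∀

    many : M ^ (2 + k) ≤ S
    many = #solutions-bound a (a≢0 zero) v sol M {{>-nonZero 0<M}}
      (≤-trans (≤-reflexive (regroup (suc (sumℕ (∣_∣ ∘ a))) M (suc n₀))) (m/n*n≤m n C))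
      where
      regroup : ∀ l m n → l * m * n ≡ m * (l * n)
      regroup = solve-∀

    nD≤KS : n * D ≤ K * S
    nD≤KS = *-cancelˡ-≤ n {{>-nonZero (≤-trans (s≤s z≤n) C≤n)}} (begin
      n * (n * D)                                           ≡⟨ sym (*-assoc n n D) ⟩
      n * n * D                                             ≤⟨ #degenerate-bound a a≢0 n ⟩
      (3 + k) * (3 + k) * (n * n ^ (2 + k))
          ≤⟨ *-monoʳ-≤ ((3 + k) * (3 + k)) (*-monoʳ-≤ n (begin
        n ^ (2 + k)                     ≤⟨ ^-monoˡ-≤ (2 + k) n≤2CM ⟩
        (2 * C * M) ^ (2 + k)           ≡⟨ ^-distribʳ-* (2 + k) (2 * C) M ⟩
        (2 * C) ^ (2 + k) * M ^ (2 + k) ≤⟨ *-monoʳ-≤ ((2 * C) ^ (2 + k)) many ⟩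
        (2 * C) ^ (2 + k) * S           ∎)) ⟩
      (3 + k) * (3 + k) * (n * ((2 * C) ^ (2 + k) * S))
          ≡⟨ regroup ((3 + k) * (3 + k)) n ((2 * C) ^ (2 + k)) S ⟩
      n * (K * S)                                           ∎)
      where
      regroup : ∀ l n c s → l * (n * (c * s)) ≡ n * (l * c * s)
      regroup = solve-∀

    bound : q * D ≤ S
    bound = *-cancelˡ-≤ K
      {{m*n≢0 ((3 + k) * (3 + k)) ((2 * C) ^ (2 + k)) {{_}} {{m^n≢0 (2 * C) (2 + k)}}}} (begin
      K * (q * D)  ≡⟨ sym (*-assoc K q D) ⟩
      K * q * D    ≤⟨ *-monoˡ-≤ D (m+n≤o⇒n≤o C N≤n) ⟩
      n * D        ≤⟨ nD≤KS ⟩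
      K * S        ∎)

-- From many colours to two

-- The many-colour bound is invoked with error `1 / (P * e)`, because passing from the average over
-- draws back to `c` magnifies errors by a power of `2 + r`. The solution `v` guarantees that
-- degenerate solutions are negligible.
common⇒2-common : ∀ (a : Vector ℤ (3 + k)) → (∀ i → a i ≢ 0ℤ) →
  ∀ {n₀} (v : Vector (Fin n₀) (3 + k)) → IsSolution a v →
  Common (2 + r) a → Common 2 a
-- The sum of the two thresholds serves as an upper bound for both.
common⇒2-common {k} {r} a a≢0 v sol common ε 0<ε = N₁ + N₂ , bound
  where
  open ≤-Reasoning
  e = ↧ₙ ε
  P = (2 + r) ^ (3 + k)
  instance
    2^≢0 : NonZero (2 ^ (2 + k))
    2^≢0 = m^n≢0 2 (2 + k)
    r^≢0 : NonZero ((2 + r) ^ (2 + k))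
    r^≢0 = m^n≢0 (2 + r) (2 + k)
    P≢0 : NonZero P
    P≢0 = m^n≢0 (2 + r) (3 + k)
    Pe≢0 : NonZero (P * e)
    Pe≢0 = m*n≢0 P e
  N₁ = proj₁ (common (+ 1 / (P * e)) (0<1/ (P * e)))
  N₂ = proj₁ (few-degenerate a a≢0 v sol (e * P))

  bound : ∀ n → N₁ + N₂ ≤ n → .{{_ : NonZero (#solutions a n)}} → (c : Colouring 2 n) →
          randomProportion 2 (3 + k) ℚ.- ε ℚ.≤ proportion a c
  bound n N≤n c = ≤-weaken-ε {randomProportion 2 (3 + k)} {+ 1 / e} (1/↧≤ 0<ε)
    (fraction-bound⁺ M S (2 ^ (2 + k)) e
      (two-colour-bound S M (#degenerate a n) P (2 ^ (2 + k)) r e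
        (recolouring-bound {r = r} a c (P * e) λ ρ → let c′ = recolouring {r = r} c ρ in
          fraction-bound⁻ (#monochromatic a c′) S ((2 + r) ^ (2 + k)) (P * e)
            (proj₂ (common (+ 1 / (P * e)) (0<1/ (P * e))) n (m+n≤o⇒m≤o N₁ N≤n) c′))
        (proj₂ (few-degenerate a a≢0 v sol (e * P)) n (m+n≤o⇒n≤o N₁ N≤n))))
    where
    S = #solutions a n
    M = #monochromatic a c

-- The irrelevant instance serves only to refute the empty list; the witness itself is the head of
-- the list.
nonempty⇒∃ : {P : A → Set} {xs : List A} → All P xs → .{{NonZero (length xs)}} → ∃ P
nonempty⇒∃ []                = ⊥-elim (≢-nonZero⁻¹ 0 refl)
nonempty⇒∃ (_∷_ {x = x} p _) = x , p

theorem1p3 : ∀ (k : ℕ) → 3 ≤ k →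
    (a : Vector ℤ k) → (∀ i → a i ≢ 0ℤ) →
    Uncommon 2 a →
    ∀ (r : ℕ) .{{_ : NonTrivial r}} → 3 ≤ r → Uncommon r a
-- Whether a has a solution in some [n] is not decided: Common 2 a is proved vacuously, since any
-- n with a solution contradicts Uncommon 2 a.
theorem1p3 (suc (suc (suc k))) _ a a≢0 uncommon (suc (suc r)) _ common =
  uncommon λ _ _ → 0 , λ n _ _ →
    let v , sol = nonempty⇒∃ (all-filter (isSolution? a) (tuples (3 + k) n))
    in ⊥-elim (uncommon (common⇒2-common {r = r} a a≢0 v sol common))
theorem1p3 (suc (suc (suc _))) _ _ _ _ (suc zero) (s≤s ())
theorem1p3 (suc zero) (s≤s ())
theorem1p3 (suc (suc zero)) (s≤s (s≤s ()))
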